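{- Every finite tournament is a subtournament of a finite Type-II regular tournament. That is, for every finite tournament $T$ there exist a finite regular tournament $R$ of Type-II and an injective map $f$ from the vertex set of $T$ to the vertex set of $R$ such that for all vertices $x,y$ of $T$, $x\to y$ in $T$ if and only if $f(x)\to f(y)$ in $R$.
   Context: A tournament is a pair $T=(V,E)$, where $V$ is a finite nonempty set of vertices and $E\subseteq V\times V$ is a relation such that $(v,v)\notin E$ for all $v$, and for any two distinct $u,v\in V$ exactly one of $(u,v)\in E$, $(v,u)\in E$ holds. We write $u\to v$ when $(u,v)\in E$. For a vertex $v$, let $\mathrm{IN}(v)=\{u\in V: u\to v\}$ and $\mathrm{OUT}(v)=\{u\in V: v\to u\}$; each of these sets (possibly empty) is regarded as carrying the edge relation induced from $T$. A tournament is regular if $|\mathrm{IN}(v)|=|\mathrm{OUT}(v)|$ for every vertex $v$. The inversion of a tournament $(V,E)$ is $(V,E^*)$ with $E^*=\{(v,u): (u,v)\in E\}$, i.e. all arrows are reversed. A regular tournament is of Type-II if there exists a vertex $v$ such that the induced subtournament on $\mathrm{IN}(v)$ is isomorphic to the inversion of the induced subtournament on $\mathrm{OUT}(v)$, i.e. there is a bijection $g:\mathrm{IN}(v)\to\mathrm{OUT}(v)$ such that for all $x,y\in \mathrm{IN}(v)$, $x\to y$ if and only if $g(y)\to g(x)$. -}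

module Defs where

open import Data.Fin.Base using (Fin)
open import Data.Nat.Base using (ℕ)
open import Data.Product.Base using (Σ; Σ-syntax; ∃-syntax; _×_; proj₁)
open import Data.Sum.Base using (_⊎_)
open import Function.Base using (flip; _on_)
open import Function.Bundles using (_↔_; _⇔_; Inverse)
open import Level using (0ℓ)
open import Relation.Binary.Core using (Rel)
open import Relation.Binary.Definitions using (Irreflexive; Irrelevant)
open import Relation.Binary.PropositionalEquality.Core using (_≡_; _≢_)
open import Relation.Nullary.Negation.Core using (¬_)
open import Relation.Unary using (Pred)

HasCardinality : Set → ℕ → Set
HasCardinality A k = A ↔ Fin k

ExactlyOne : Set → Set → Set
ExactlyOne A B = (A × ¬ B) ⊎ (B × ¬ A)

-- Bare digraphs are kept separate from tournaments because the structures
-- induced on in- and out-neighbourhoods may be empty.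
record Digraph : Set₁ where
  field
    Vertex : Set
    Edge   : Rel Vertex 0ℓ

open Digraph public

induced : (G : Digraph) → Pred (Vertex G) 0ℓ → Digraph
induced G P = record { Vertex = Σ (Vertex G) P ; Edge = Edge G on proj₁ }

inversion : Digraph → Digraph
inversion G = record { Vertex = Vertex G ; Edge = flip (Edge G) }

infix 4 _≅_

_≅_ : Digraph → Digraph → Set
G ≅ H = Σ[ g ∈ (Vertex G ↔ Vertex H) ]
  (∀ x y → Edge G x y ⇔ Edge H (Inverse.to g x) (Inverse.to g y))

record Tournament : Set₁ where
  field
    digraph          : Digraph
    finite           : ∃[ n ] HasCardinality (Vertex digraph) n
    nonempty         : Vertex digraph
    -- The edges form a subset of V × V: without this, the Σ-types over IN v and
    -- OUT v used for cardinalities and isomorphisms could repeat vertices.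
    edge-irrelevant  : Irrelevant (Edge digraph)
    edge-irreflexive : Irreflexive _≡_ (Edge digraph)
    edge-exactlyOne  : ∀ u v → u ≢ v → ExactlyOne (Edge digraph u v) (Edge digraph v u)

  V : Set
  V = Vertex digraph

  infix 4 _⟶_

  _⟶_ : Rel V 0ℓ
  _⟶_ = Edge digraph

  IN : V → Pred V 0ℓ
  IN v u = u ⟶ v

  OUT : V → Pred V 0ℓ
  OUT v u = v ⟶ u

Regular : Tournament → Set
Regular T = ∀ v → ∃[ k ] HasCardinality (Σ V (IN v)) k × HasCardinality (Σ V (OUT v)) k
  where open Tournament T

-- Type-II is a property of regular tournaments, so regularity is included.
TypeII : Tournament → Set
TypeII T = Regular T × ∃[ v ] induced digraph (IN v) ≅ inversion (induced digraph (OUT v))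
  where open Tournament T

{-# OPTIONS --safe #-}

-- A tournament T embeds in the self-dual tournament T ⇒ T*, in which every
-- vertex of T dominates every vertex of the inversion T*.  Every T moreover
-- embeds in a regular tournament consisting of two copies of T and an apex,
-- with low x → apex → high x, and low x → high y exactly when y → x in T.  There
-- the in- and out-neighbourhoods of the apex are copies of T, so that it is of
-- Type II as soon as T is self-dual.
module Submission where

open import Defs
open import Axiom.UniquenessOfIdentityProofs using (module Decidable⇒UIP)
open import Data.Empty using (⊥; ⊥-elim)
open import Data.Fin.Properties using (+↔⊎; 1↔⊤; inj⇒≟)
open import Data.Nat.Base using (_+_)
open import Data.Product.Base using (Σ; Σ-syntax; _×_; _,_; proj₁; proj₂)
open import Data.Sum.Base using (_⊎_; inj₁; inj₂; swap)
open import Data.Sum.Function.Propositional using (_⊎-↔_)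
open import Data.Sum.Properties using (swap-↔)
open import Data.Unit.Base using (⊤; tt)
open import Function.Base using (id; _∘_)
open import Function.Bundles using (_↔_; _⇔_; mk↔ₛ′; mk⇔)
open import Function.Construct.Composition using (_↔-∘_)
open import Function.Construct.Symmetry using (↔-sym)
open import Function.Definitions using (Injective)
open import Function.Properties.Inverse using (↔⇒↣)
open import Level using (0ℓ)
open import Relation.Binary.Core using (Rel)
open import Relation.Binary.Definitions
  using (DecidableEquality; Irrelevant; Trichotomous; tri<; tri≈; tri>)
open import Relation.Binary.PropositionalEquality.Core
  using (_≡_; _≢_; refl; sym; cong)
open import Relation.Nullary.Decidable.Core using (yes; no)
open import Relation.Nullary.Negation.Core using (¬_)
import Relation.Unary as Unary

-- Cardinalities and bijections with subsets.

HasCardinality-⊎ : ∀ {A B m n} → HasCardinality A m → HasCardinality B n →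
                   HasCardinality (A ⊎ B) (m + n)
HasCardinality-⊎ A↔m B↔n = ↔-sym +↔⊎ ↔-∘ (A↔m ⊎-↔ B↔n)

module _ {A B : Set} {P : Unary.Pred B 0ℓ} (P-irrelevant : ∀ b (p q : P b) → p ≡ q)
         (section : A → B) (retraction : B → A)
         (section∈P : ∀ a → P (section a))
         (retraction∘section : ∀ a → retraction (section a) ≡ a)
         (section∘retraction : ∀ b → P b → section (retraction b) ≡ b) where

  private
    Σ-≡ : ∀ {b c} (p : P b) (q : P c) → b ≡ c → (b , p) ≡ (c , q)
    Σ-≡ p q refl = cong (_ ,_) (P-irrelevant _ p q)

  -- As `P` is proof-irrelevant, equality in `Σ B P` is equality of first components. The inverse
  -- law for `section` is assumed only on `P`, so `retraction` may be arbitrary elsewhere.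
  subset↔ : Σ B P ↔ A
  subset↔ = mk↔ₛ′ (retraction ∘ proj₁) (λ a → section a , section∈P a)
    retraction∘section
    (λ (b , p) → Σ-≡ _ p (section∘retraction b p))

module TournamentProperties (T : Tournament) where
  open Tournament T

  infix 4 _≟_

  _≟_ : DecidableEquality V
  _≟_ = inj⇒≟ (↔⇒↣ (proj₂ finite))

  -- Hedberg's theorem, applied to the decidable equality that finiteness provides. It serves the
  -- edges of the doubling that contain an equality of vertices.
  ≡-irrelevant : Irrelevant (_≡_ {A = V})
  ≡-irrelevant = Decidable⇒UIP.≡-irrelevant _≟_

  compare : Trichotomous _≡_ _⟶_
  compare u v with u ≟ v
  ... | yes u≡v = tri≈ (edge-irreflexive u≡v) u≡v (edge-irreflexive (sym u≡v))
  ... | no  u≢v with edge-exactlyOne u v u≢v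
  ...   | inj₁ (u⟶v , v⟶̸u) = tri< u⟶v u≢v v⟶̸u
  ...   | inj₂ (v⟶u , u⟶̸v) = tri> u⟶̸v u≢v v⟶u

-- The self-dual extension.

module SelfDual (T : Tournament) where
  open Tournament T

  DualEdge : Rel (V ⊎ V) 0ℓ
  DualEdge (inj₁ x) (inj₁ y) = x ⟶ y
  DualEdge (inj₁ x) (inj₂ y) = ⊤
  DualEdge (inj₂ x) (inj₁ y) = ⊥
  DualEdge (inj₂ x) (inj₂ y) = y ⟶ x

  dualDigraph : Digraph
  dualDigraph = record { Vertex = V ⊎ V ; Edge = DualEdge }

  DualEdge-irrelevant : ∀ u v (p q : DualEdge u v) → p ≡ q
  DualEdge-irrelevant (inj₁ x) (inj₁ y) p q = edge-irrelevant p q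
  DualEdge-irrelevant (inj₁ x) (inj₂ y) p q = refl
  DualEdge-irrelevant (inj₂ x) (inj₂ y) p q = edge-irrelevant p q

  DualEdge-irreflexive : ∀ u v → u ≡ v → ¬ DualEdge u v
  DualEdge-irreflexive (inj₁ x) _ refl = edge-irreflexive refl
  DualEdge-irreflexive (inj₂ x) _ refl = edge-irreflexive refl

  DualEdge-exactlyOne : ∀ u v → u ≢ v → ExactlyOne (DualEdge u v) (DualEdge v u)
  DualEdge-exactlyOne (inj₁ x) (inj₁ y) u≢v = edge-exactlyOne x y (u≢v ∘ cong inj₁)
  DualEdge-exactlyOne (inj₁ x) (inj₂ y) u≢v = inj₁ (tt , id)
  DualEdge-exactlyOne (inj₂ x) (inj₁ y) u≢v = inj₂ (tt , id)
  DualEdge-exactlyOne (inj₂ x) (inj₂ y) u≢v = swap (edge-exactlyOne x y (u≢v ∘ cong inj₂))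

  selfDual : Tournament
  selfDual = record
    { digraph          = dualDigraph
    ; finite           = _ , HasCardinality-⊎ (proj₂ finite) (proj₂ finite)
    ; nonempty         = inj₁ nonempty
    ; edge-irrelevant  = λ {u} {v} → DualEdge-irrelevant u v
    ; edge-irreflexive = DualEdge-irreflexive _ _
    ; edge-exactlyOne  = DualEdge-exactlyOne
    }

  -- Exchanging the two copies turns each edge type into its own reversal by definition: inside a
  -- copy the arrows flip, and across the copies flipping and exchanging cancel.
  selfDual≅inversion : dualDigraph ≅ inversion dualDigraph
  selfDual≅inversion = swap-↔ , edges
    where
    edges : ∀ u v → DualEdge u v ⇔ DualEdge (swap v) (swap u)
    edges (inj₁ x) (inj₁ y) = mk⇔ id id
    edges (inj₁ x) (inj₂ y) = mk⇔ id id
    edges (inj₂ x) (inj₁ y) = mk⇔ id id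
    edges (inj₂ x) (inj₂ y) = mk⇔ id id

-- The doubling with an apex.

module Doubling (T : Tournament) where
  open Tournament T
  open TournamentProperties T

  DoubleV : Set
  DoubleV = ⊤ ⊎ (V ⊎ V)

  pattern apex   = inj₁ tt
  pattern low x  = inj₂ (inj₁ x)
  pattern high x = inj₂ (inj₂ x)

  DoubleEdge : Rel DoubleV 0ℓ
  DoubleEdge apex     apex     = ⊥
  DoubleEdge apex     (low y)  = ⊥
  DoubleEdge apex     (high y) = ⊤
  DoubleEdge (low x)  apex     = ⊤
  DoubleEdge (low x)  (low y)  = x ⟶ y
  DoubleEdge (low x)  (high y) = y ⟶ x
  DoubleEdge (high x) apex     = ⊥
  -- The complement of `low y` → `high x`. The diagonal edge `high x` → `low x` offsets the apex,
  -- which dominates `high x` and is dominated by `low x`.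
  DoubleEdge (high x) (low y)  = x ≡ y ⊎ y ⟶ x
  DoubleEdge (high x) (high y) = x ⟶ y

  doubleDigraph : Digraph
  doubleDigraph = record { Vertex = DoubleV ; Edge = DoubleEdge }

  DoubleEdge-irrelevant : ∀ u v (p q : DoubleEdge u v) → p ≡ q
  DoubleEdge-irrelevant apex     (high y) p q = refl
  DoubleEdge-irrelevant (low x)  apex     p q = refl
  DoubleEdge-irrelevant (low x)  (low y)  p q = edge-irrelevant p q
  DoubleEdge-irrelevant (low x)  (high y) p q = edge-irrelevant p q
  DoubleEdge-irrelevant (high x) (low y)  (inj₁ p) (inj₁ q) = cong inj₁ (≡-irrelevant p q)
  -- Irreflexivity makes the two summands mutually exclusive.
  DoubleEdge-irrelevant (high x) (low y)  (inj₁ p) (inj₂ q) = ⊥-elim (edge-irreflexive (sym p) q)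
  DoubleEdge-irrelevant (high x) (low y)  (inj₂ p) (inj₁ q) = ⊥-elim (edge-irreflexive (sym q) p)
  DoubleEdge-irrelevant (high x) (low y)  (inj₂ p) (inj₂ q) = cong inj₂ (edge-irrelevant p q)
  DoubleEdge-irrelevant (high x) (high y) p q = edge-irrelevant p q

  DoubleEdge-irreflexive : ∀ u v → u ≡ v → ¬ DoubleEdge u v
  DoubleEdge-irreflexive apex     _ refl = id
  DoubleEdge-irreflexive (low x)  _ refl = edge-irreflexive refl
  DoubleEdge-irreflexive (high x) _ refl = edge-irreflexive refl

  -- `low x` and `high x` are distinct vertices, so the diagonal has to be decided as well; there
  -- the equality summand supplies the edge.
  low-high-exactlyOne : ∀ x y → ExactlyOne (y ⟶ x) (y ≡ x ⊎ x ⟶ y)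
  low-high-exactlyOne x y with compare y x
  ... | tri< y⟶x y≢x x⟶̸y = inj₁ (y⟶x , λ { (inj₁ y≡x) → y≢x y≡x ; (inj₂ x⟶y) → x⟶̸y x⟶y })
  ... | tri≈ y⟶̸x y≡x x⟶̸y = inj₂ (inj₁ y≡x , y⟶̸x)
  ... | tri> y⟶̸x y≢x x⟶y = inj₂ (inj₂ x⟶y , y⟶̸x)

  DoubleEdge-exactlyOne : ∀ u v → u ≢ v → ExactlyOne (DoubleEdge u v) (DoubleEdge v u)
  DoubleEdge-exactlyOne apex     apex     u≢v = ⊥-elim (u≢v refl)
  DoubleEdge-exactlyOne apex     (low y)  u≢v = inj₂ (tt , id)
  DoubleEdge-exactlyOne apex     (high y) u≢v = inj₁ (tt , id)
  DoubleEdge-exactlyOne (low x)  apex     u≢v = inj₁ (tt , id)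
  DoubleEdge-exactlyOne (low x)  (low y)  u≢v = edge-exactlyOne x y (u≢v ∘ cong (λ z → low z))
  DoubleEdge-exactlyOne (low x)  (high y) u≢v = low-high-exactlyOne x y
  DoubleEdge-exactlyOne (high x) apex     u≢v = inj₂ (tt , id)
  DoubleEdge-exactlyOne (high x) (low y)  u≢v = swap (low-high-exactlyOne y x)
  DoubleEdge-exactlyOne (high x) (high y) u≢v = edge-exactlyOne x y (u≢v ∘ cong (λ z → high z))

  double : Tournament
  double = record
    { digraph          = doubleDigraph
    ; finite           = _ , HasCardinality-⊎ (↔-sym 1↔⊤)
                               (HasCardinality-⊎ (proj₂ finite) (proj₂ finite))
    ; nonempty         = apex
    ; edge-irrelevant  = λ {u} {v} → DoubleEdge-irrelevant u v
    ; edge-irreflexive = DoubleEdge-irreflexive _ _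
    ; edge-exactlyOne  = DoubleEdge-exactlyOne
    }

  -- Regularity: every neighbourhood is a copy of `V`.

  open Tournament double using () renaming (IN to DoubleIN; OUT to DoubleOUT)

  -- Each neighbourhood of low x or high x contains exactly one of low y and
  -- high y for y ≢ x, and exactly one of low x, high x and apex.  Sending apex
  -- to x therefore identifies the neighbourhood with V.
  project : V → DoubleV → V
  project x apex     = x
  project x (low y)  = y
  project x (high y) = y

  module _ (x : V) where

    -- The inverses of `project x` on the neighbourhoods of `low x` and `high x` all have this shape
    -- and differ only in the three values.
    choose : (lt eq gt : V → DoubleV) → V → DoubleV
    choose lt eq gt y with compare x y
    ... | tri< _ _ _ = lt y
    ... | tri≈ _ _ _ = eq y
    ... | tri> _ _ _ = gt y

    module _ {lt eq gt : V → DoubleV} where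

      -- Performs the case split once. Instances of `Q` give both that the chosen vertex is a
      -- neighbour and that it projects back to `y`.
      choose-elim : (Q : V → DoubleV → Set) →
                    (∀ y → x ⟶ y → Q y (lt y)) → Q x (eq x) → (∀ y → y ⟶ x → Q y (gt y)) →
                    ∀ y → Q y (choose lt eq gt y)
      choose-elim Q q< q≈ q> y with compare x y
      ... | tri< x⟶y _ _ = q< y x⟶y
      ... | tri≈ _ refl _ = q≈
      ... | tri> _ _ y⟶x = q> y y⟶x

      -- This rule and the next two recover a neighbour from its projection, its edge to or from `x`
      -- telling which case applies.
      choose-lt : ∀ {y} → x ⟶ y → choose lt eq gt y ≡ lt y
      choose-lt {y} x⟶y with compare x y
      ... | tri< _ _ _ = refl
      ... | tri≈ x⟶̸y _ _ = ⊥-elim (x⟶̸y x⟶y)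
      ... | tri> x⟶̸y _ _ = ⊥-elim (x⟶̸y x⟶y)

      choose-eq : choose lt eq gt x ≡ eq x
      choose-eq with compare x x
      ... | tri< _ x≢x _ = ⊥-elim (x≢x refl)
      ... | tri≈ _ _ _ = refl
      ... | tri> _ x≢x _ = ⊥-elim (x≢x refl)

      choose-gt : ∀ {y} → y ⟶ x → choose lt eq gt y ≡ gt y
      choose-gt {y} y⟶x with compare x y
      ... | tri< _ _ y⟶̸x = ⊥-elim (y⟶̸x y⟶x)
      ... | tri≈ _ _ y⟶̸x = ⊥-elim (y⟶̸x y⟶x)
      ... | tri> _ _ _ = refl

  IN-apex↔V : Σ DoubleV (DoubleIN apex) ↔ V
  -- `nonempty` is a dummy value: `apex` is not its own neighbour.
  IN-apex↔V = subset↔ (λ w → DoubleEdge-irrelevant w apex) (λ y → low y) (project nonempty)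
    (λ _ → tt) (λ _ → refl) λ { apex () ; (low y) _ → refl ; (high y) () }

  OUT-apex↔V : Σ DoubleV (DoubleOUT apex) ↔ V
  OUT-apex↔V = subset↔ (λ w → DoubleEdge-irrelevant apex w) (λ y → high y) (project nonempty)
    (λ _ → tt) (λ _ → refl) λ { apex () ; (low y) () ; (high y) _ → refl }

  IN-low↔V : ∀ x → Σ DoubleV (DoubleIN (low x)) ↔ V
  IN-low↔V x = subset↔ (λ w → DoubleEdge-irrelevant w (low x))
    (choose x (λ y → high y) (λ y → high y) (λ y → low y)) (project x)
    (choose-elim x (λ _ w → DoubleEdge w (low x)) (λ _ → inj₂) (inj₁ refl) (λ _ → id))
    (choose-elim x (λ y w → project x w ≡ y) (λ _ _ → refl) refl (λ _ _ → refl))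
    λ { (low y)  y⟶x         → choose-gt x y⟶x
      ; (high y) (inj₁ refl) → choose-eq x
      ; (high y) (inj₂ x⟶y)  → choose-lt x x⟶y }

  OUT-low↔V : ∀ x → Σ DoubleV (DoubleOUT (low x)) ↔ V
  OUT-low↔V x = subset↔ (λ w → DoubleEdge-irrelevant (low x) w)
    -- The diagonal slot goes to `apex`, because `high x` is an in-neighbour of `low x`.
    (choose x (λ y → low y) (λ _ → apex) (λ y → high y)) (project x)
    (choose-elim x (λ _ w → DoubleEdge (low x) w) (λ _ → id) tt (λ _ → id))
    (choose-elim x (λ y w → project x w ≡ y) (λ _ _ → refl) refl (λ _ _ → refl))
    λ { apex     _   → choose-eq x
      ; (low y)  x⟶y → choose-lt x x⟶y
      ; (high y) y⟶x → choose-gt x y⟶x }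

  IN-high↔V : ∀ x → Σ DoubleV (DoubleIN (high x)) ↔ V
  IN-high↔V x = subset↔ (λ w → DoubleEdge-irrelevant w (high x))
    (choose x (λ y → low y) (λ _ → apex) (λ y → high y)) (project x)
    (choose-elim x (λ _ w → DoubleEdge w (high x)) (λ _ → id) tt (λ _ → id))
    (choose-elim x (λ y w → project x w ≡ y) (λ _ _ → refl) refl (λ _ _ → refl))
    λ { apex     _   → choose-eq x
      ; (low y)  x⟶y → choose-lt x x⟶y
      ; (high y) y⟶x → choose-gt x y⟶x }

  OUT-high↔V : ∀ x → Σ DoubleV (DoubleOUT (high x)) ↔ V
  OUT-high↔V x = subset↔ (λ w → DoubleEdge-irrelevant (high x) w)
    (choose x (λ y → high y) (λ y → low y) (λ y → low y)) (project x)
    (choose-elim x (λ _ w → DoubleEdge (high x) w) (λ _ → id) (inj₁ refl) (λ _ → inj₂))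
    (choose-elim x (λ y w → project x w ≡ y) (λ _ _ → refl) refl (λ _ _ → refl))
    λ { (low y)  (inj₁ refl) → choose-eq x
      ; (low y)  (inj₂ y⟶x)  → choose-gt x y⟶x
      ; (high y) x⟶y         → choose-lt x x⟶y }

  -- The common size is always that of `V`.
  double-regular : Regular double
  double-regular apex     = _ , proj₂ finite ↔-∘ IN-apex↔V , proj₂ finite ↔-∘ OUT-apex↔V
  double-regular (low x)  = _ , proj₂ finite ↔-∘ IN-low↔V x , proj₂ finite ↔-∘ OUT-low↔V x
  double-regular (high x) = _ , proj₂ finite ↔-∘ IN-high↔V x , proj₂ finite ↔-∘ OUT-high↔V x

  double-typeII : digraph ≅ inversion digraph → TypeII double
  double-typeII (g , g-edges) = double-regular , apex ,
    ↔-sym OUT-apex↔V ↔-∘ (g ↔-∘ IN-apex↔V) ,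
    -- Inside the low and the high copy alike `DoubleEdge` reduces to `_⟶_`, so `g-edges` applies
    -- unchanged.
    λ { (low x , _) (low y , _) → g-edges x y }

corollary4p8 : (T : Tournament) →
    Σ[ R ∈ Tournament ]
    Regular R × TypeII R ×
    (Σ[ f ∈ (Tournament.V T → Tournament.V R) ]
    Injective _≡_ _≡_ f ×
    (∀ x y → Tournament._⟶_ T x y ⇔ Tournament._⟶_ R (f x) (f y)))
corollary4p8 T =
  double , double-regular , double-typeII selfDual≅inversion ,
  -- In the low half, on the unreversed copy of `T`, the edge relation reduces to that of `T`.
  (λ x → low (inj₁ x)) , (λ { refl → refl }) , λ x y → mk⇔ id id
  where
  open SelfDual T
  open Doubling selfDual
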